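{- Let $n\ge 1$ and $k\ge 1$ be natural numbers with $k$ even, and suppose that $n\equiv 0 \pmod k$ or $n\equiv k-1 \pmod k$. If there is a symmetric $((n^2+n+k)_{n+1})$ configuration that satisfies the transitivity of parallels (TOPs) property, then either 1. $\frac{n^2+n}{k}$ is even and $n+1$ is a perfect square, or 2. $\frac{n^2+n}{k}$ is odd and $n-(k-1)$ is a perfect square.
   Context: A symmetric $(v_r)$ configuration is a pair $(\mathcal P,\mathcal L)$ where $\mathcal P$ is a finite set of $v$ points, $v\ge 3$, and $\mathcal L$ is a set of $v$ lines, each line being a subset of $\mathcal P$, such that each line contains exactly $r$ points, each point lies on exactly $r$ lines, and any two distinct points lie together on at most one line (equivalently, any two distinct lines share at most one point). Configurations are assumed connected: $\mathcal P$ cannot be split into two nonempty parts such that every line lies inside one of the parts. A $((n^2+n+k)_{n+1})$ configuration is a symmetric $(v_r)$ configuration with $v=n^2+n+k$ and $r=n+1$; $k$ is called its deficiency. Two lines are parallel (non-intersecting) if they have no point in common. A configuration has the transitivity of parallels (TOPs) property if, for all pairwise distinct lines $l_1,l_2,l_3$, whenever $l_1$ is parallel to both $l_2$ and $l_3$, then $l_2$ is parallel to $l_3$. Perfect squares include $0$. -}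

module Defs where

open import Data.Nat using (ℕ; _*_; _≤_)
open import Data.Fin using (Fin)
open import Data.Fin.Subset using (Subset; _∈_; _⊆_; _∩_; ∁; ∣_∣; Nonempty; Empty)
open import Data.Product using (∃; _×_)
open import Data.Sum using (_⊎_)
open import Data.Vec using (lookup; tabulate)
open import Function.Definitions using (Injective)
open import Relation.Binary.PropositionalEquality using (_≡_; _≢_)
open import Relation.Nullary using (¬_)

IsSquare : ℕ → Set
IsSquare n = ∃ λ m → n ≡ m * m

-- The set of indices of the lines incident with p, so that its size is the
-- number of lines on p.
linesOn : ∀ {v b} → (Fin b → Subset v) → Fin v → Subset b
linesOn line p = tabulate λ l → lookup (line l) p

-- A connected symmetric (v_r) configuration on the point set Fin v.  The set
-- of v lines is given by an injective enumeration, so equality of line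
-- indices is equality of lines as point sets.
record Configuration (v r : ℕ) : Set where
  field
    line           : Fin v → Subset v
    line-injective : Injective _≡_ _≡_ line
    3≤v            : 3 ≤ v
    line-size      : ∀ l → ∣ line l ∣ ≡ r
    point-degree   : ∀ p → ∣ linesOn line p ∣ ≡ r
    linear         : ∀ {p q l m} → p ≢ q →
                     p ∈ line l → q ∈ line l →
                     p ∈ line m → q ∈ line m → l ≡ m
    connected      : ¬ (∃ λ (S : Subset v) →
                        Nonempty S × Nonempty (∁ S) ×
                        (∀ l → line l ⊆ S ⊎ line l ⊆ ∁ S))

  Parallel : Fin v → Fin v → Set
  Parallel l m = Empty (line l ∩ line m)

TransitiveParallels : ∀ {v r} → Configuration v r → Set
TransitiveParallels C =
  ∀ l₁ l₂ l₃ → l₁ ≢ l₂ → l₁ ≢ l₃ → l₂ ≢ l₃ →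
  Parallel l₁ l₂ → Parallel l₁ l₃ → Parallel l₂ l₃
  where open Configuration C

{-# OPTIONS --safe #-}

-- Counting shows that the parallel classes all have k lines, so in ℚ^v the
-- incidence vectors of the lines have inner product n + 1 with themselves, 0
-- with parallel lines and 1 with all others.  Helmert contrasts, first inside
-- each class and then between the class sums, turn them into v pairwise
-- orthogonal nonzero integer vectors.  The norms of an orthogonal basis of ℚ^v
-- multiply to a square; here the product is, up to squares,
-- (n + 1)^((k − 1) m) (n + 1 − k)^(m − 1) with m = (n² + n)/k + 1 classes, and
-- k − 1 is odd.
--
-- Instead of determinants, the statement on norms is proved by splitting off
-- one basis vector at a time with rotations of coordinate planes, for a
-- diagonal form whose coefficients are adjusted along the way.
module Submission where

open import Defs
open import Data.Bool using (Bool; true; false)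
open import Data.Fin as Fin using (Fin)
import Data.Fin.Properties as Fin
open import Data.Fin.Subset using (Subset; Nonempty; Empty; _∩_; ⁅_⁆; inside; outside)
  renaming (∣_∣ to size; _∈_ to _∈ₛ_)
open import Data.Fin.Subset.Properties using
  (Empty-unique; ∣⊥∣≡0; ∣⁅x⁆∣≡1; x∈⁅x⁆; x∈⁅y⁆⇒x≡y; ⊆-antisym; nonempty?; ∩-idem; ∩-comm; x∈p∩q⁻)
open import Data.List as List using (List; []; _∷_; _++_; length; map; concat; filter)
open import Data.List.Membership.Propositional using (_∈_)
open import Data.List.Membership.Propositional.Properties using (∈-allFin; ∈-filter⁻)
open import Data.List.Properties using
  (length-map; length-++; length-tabulate; length-filter; filter-accept; filter-reject; map-tabulate)
open import Data.List.Relation.Unary.All as All using (All; []; _∷_)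
import Data.List.Relation.Unary.All.Properties as All
open import Data.List.Relation.Unary.AllPairs as AllPairs using (AllPairs; []; _∷_)
import Data.List.Relation.Unary.AllPairs.Properties as AllPairs
open import Data.List.Relation.Unary.Any using (here; there)
open import Data.List.Relation.Unary.Unique.Propositional using (Unique)
import Data.List.Relation.Unary.Unique.Propositional.Properties as Unique
open import Data.Nat as ℕ using (ℕ; zero; suc; NonZero; _/_; _%_; _∸_)
open import Data.Nat.Coprimality using (coprime-divisor; coprime-/gcd)
open import Data.Nat.Divisibility using (_∣_; _∤_; divides)
import Data.Nat.Divisibility as ℕ
open import Data.Nat.DivMod using (m/n*n≡m; m*n/n≡m; m<n⇒m%n≡m)
open import Data.Nat.GCD using (gcd; gcd[m,n]∣m; gcd[m,n]∣n; gcd[m,n]≢0)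
import Data.Nat.Properties as ℕ
open import Data.Nat.Tactic.RingSolver using () renaming (solve-∀ to ℕ-solve-∀)
open import Data.Product using (∃; _×_; _,_; proj₁; proj₂)
open import Data.Sum as Sum using (_⊎_; inj₁; inj₂)
open import Data.Vec as Vec using (Vec; []; _∷_)
open import Data.Vec.Properties using (lookup-zipWith; lookup-map; lookup-replicate)
open import Data.Vec.Relation.Unary.All as VAll using ([]; _∷_)
import Data.Vec.Relation.Unary.All.Properties as VAll
open import Function using (_∘_)
open import Relation.Binary using (Setoid; Decidable; tri<; tri≈; tri>)
import Relation.Binary.Reasoning.Setoid as SetoidReasoning
open import Relation.Binary.PropositionalEquality
open import Relation.Nullary using (¬_; yes; no; contradiction; ¬?)
open import Relation.Nullary.Decidable using (_⊎-dec_)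

module _ where
  open import Data.Integer using
    (ℤ; +_; 0ℤ; 1ℤ; _+_; _-_; -_; _*_; _^_; _≤_; _<_; +<+; +[1+_]; -[1+_]; ∣_∣)
  open import Data.Integer.Properties
  open import Data.Integer.Tactic.RingSolver using (solve-∀)

  -- Square classes of integers

  infix 4 _≈_

  -- Equality modulo nonzero rational squares, with the denominators cleared so that all computation
  -- stays in ℤ.
  record _≈_ (x y : ℤ) : Set where
    constructor square-ratio
    field
      p q : ℤ
      p≢0 : p ≢ 0ℤ
      q≢0 : q ≢ 0ℤ
      eq  : x * (p * p) ≡ y * (q * q)

  *-≢0 : ∀ {x y} → x ≢ 0ℤ → y ≢ 0ℤ → x * y ≢ 0ℤ
  *-≢0 {x} x≢0 y≢0 xy≡0 with i*j≡0⇒i≡0∨j≡0 x xy≡0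
  ... | inj₁ x≡0 = x≢0 x≡0
  ... | inj₂ y≡0 = y≢0 y≡0

  ≈-square-factor : ∀ x {t} → t ≢ 0ℤ → x * (t * t) ≈ x
  ≈-square-factor x {t} t≢0 = square-ratio 1ℤ t (λ ()) t≢0 (*-identityʳ (x * (t * t)))

  ≈-reflexive : ∀ {x y} → x ≡ y → x ≈ y
  ≈-reflexive {x} refl = square-ratio 1ℤ 1ℤ (λ ()) (λ ()) refl

  ≈-sym : ∀ {x y} → x ≈ y → y ≈ x
  ≈-sym (square-ratio p q p≢0 q≢0 eq) = square-ratio q p q≢0 p≢0 (sym eq)

  *-interchange : ∀ x y z w → (x * y) * (z * w) ≡ (x * z) * (y * w)
  *-interchange = solve-∀

  ≈-trans : ∀ {x y z} → x ≈ y → y ≈ z → x ≈ z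
  ≈-trans {x} {y} {z} (square-ratio p q p≢0 q≢0 eq) (square-ratio r s r≢0 s≢0 eq′) =
    square-ratio (p * r) (q * s) (*-≢0 p≢0 r≢0) (*-≢0 q≢0 s≢0) (begin
      x * ((p * r) * (p * r))   ≡⟨ reassoc x p r ⟩
      (x * (p * p)) * (r * r)   ≡⟨ cong (_* (r * r)) eq ⟩
      (y * (q * q)) * (r * r)   ≡⟨ swap y q r ⟩
      (y * (r * r)) * (q * q)   ≡⟨ cong (_* (q * q)) eq′ ⟩
      (z * (s * s)) * (q * q)   ≡⟨ reassoc′ z s q ⟩
      z * ((q * s) * (q * s))   ∎)
    where
    open ≡-Reasoning
    reassoc : ∀ x p r → x * ((p * r) * (p * r)) ≡ (x * (p * p)) * (r * r)
    reassoc = solve-∀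
    reassoc′ : ∀ z s q → (z * (s * s)) * (q * q) ≡ z * ((q * s) * (q * s))
    reassoc′ = solve-∀
    swap : ∀ y q r → (y * (q * q)) * (r * r) ≡ (y * (r * r)) * (q * q)
    swap = solve-∀

  ≈-setoid : Setoid _ _
  ≈-setoid = record
    { Carrier = ℤ
    ; _≈_ = _≈_
    ; isEquivalence = record { refl = ≈-reflexive refl ; sym = ≈-sym ; trans = ≈-trans }
    }

  module ≈-Reasoning = SetoidReasoning ≈-setoid

  ≈-*-cong : ∀ {x y z w} → x ≈ y → z ≈ w → x * z ≈ y * w
  ≈-*-cong {x} {y} {z} {w} (square-ratio p q p≢0 q≢0 eq) (square-ratio r s r≢0 s≢0 eq′) =
    square-ratio (p * r) (q * s) (*-≢0 p≢0 r≢0) (*-≢0 q≢0 s≢0) (begin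
      (x * z) * ((p * r) * (p * r))     ≡⟨ distribute x z p r ⟩
      (x * (p * p)) * (z * (r * r))     ≡⟨ cong₂ _*_ eq eq′ ⟩
      (y * (q * q)) * (w * (s * s))     ≡⟨ distribute y w q s ⟨
      (y * w) * ((q * s) * (q * s))     ∎)
    where
    open ≡-Reasoning
    distribute : ∀ x z p r → (x * z) * ((p * r) * (p * r)) ≡ (x * (p * p)) * (z * (r * r))
    distribute = solve-∀

  ≈-refl : ∀ x → x ≈ x
  ≈-refl x = ≈-reflexive refl

  ≈-*-congˡ : ∀ x {y z} → y ≈ z → x * y ≈ x * z
  ≈-*-congˡ x = ≈-*-cong (≈-refl x)

  ≈-^-cong : ∀ {x y} n → x ≈ y → x ^ n ≈ y ^ n
  ≈-^-cong zero    x≈y = ≈-reflexive refl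
  ≈-^-cong (suc n) x≈y = ≈-*-cong x≈y (≈-^-cong n x≈y)

  ^-≢0 : ∀ {x} n → x ≢ 0ℤ → x ^ n ≢ 0ℤ
  ^-≢0 zero    x≢0 = λ ()
  ^-≢0 (suc n) x≢0 = *-≢0 x≢0 (^-≢0 n x≢0)

  ^-even-≈ : ∀ {x} n → x ≢ 0ℤ → x ^ (n ℕ.* 2) ≈ 1ℤ
  ^-even-≈ zero    x≢0 = ≈-reflexive refl
  ^-even-≈ {x} (suc n) x≢0 =
    ≈-trans (≈-reflexive (commute x (x ^ (n ℕ.* 2))))
      (≈-trans (≈-square-factor _ x≢0) (^-even-≈ n x≢0))
    where
    commute : ∀ x y → x * (x * y) ≡ y * (x * x)
    commute = solve-∀

  ^-odd-≈ : ∀ {x} n → x ≢ 0ℤ → x ^ suc (n ℕ.* 2) ≈ x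
  ^-odd-≈ {x} n x≢0 =
    ≈-trans (≈-*-cong (≈-reflexive (refl {x = x})) (^-even-≈ n x≢0)) (≈-reflexive (*-identityʳ x))

  ^-distribʳ-* : ∀ x y n → (x * y) ^ n ≡ x ^ n * y ^ n
  ^-distribʳ-* x y zero    = refl
  ^-distribʳ-* x y (suc n) =
    trans (cong (_*_ (x * y)) (^-distribʳ-* x y n)) (*-interchange x y (x ^ n) (y ^ n))

  -- Reduce the rational root `n / m` to lowest terms `q₂ / q₁`. Then `q₁` divides `q₂ * q₂` and is
  -- coprime to `q₂`, so it divides `q₂` and must be 1.
  square-quotient : ∀ a m n → m ≢ 0 → a ℕ.* (m ℕ.* m) ≡ n ℕ.* n → IsSquare a
  square-quotient a m n m≢0 eq = q₂ , a≡q₂²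
    where
    d = gcd m n
    instance
      d-nonZero : NonZero d
      d-nonZero = ℕ.≢-nonZero (gcd[m,n]≢0 m n (inj₁ m≢0))
      d²-nonZero : NonZero (d ℕ.* d)
      d²-nonZero = ℕ.m*n≢0 d d
    q₁ = m / d
    q₂ = n / d
    q₁d≡m : q₁ ℕ.* d ≡ m
    q₁d≡m = m/n*n≡m (gcd[m,n]∣m m n)
    q₂d≡n : q₂ ℕ.* d ≡ n
    q₂d≡n = m/n*n≡m (gcd[m,n]∣n m n)
    reduced : a ℕ.* (q₁ ℕ.* q₁) ≡ q₂ ℕ.* q₂
    reduced = ℕ.*-cancelʳ-≡ _ _ (d ℕ.* d) (begin
      a ℕ.* (q₁ ℕ.* q₁) ℕ.* (d ℕ.* d)     ≡⟨ ℕ.*-assoc a (q₁ ℕ.* q₁) (d ℕ.* d) ⟩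
      a ℕ.* (q₁ ℕ.* q₁ ℕ.* (d ℕ.* d))     ≡⟨ cong (a ℕ.*_) (ℕ.[m*n]*[o*p]≡[m*o]*[n*p] q₁ q₁ d d) ⟩
      a ℕ.* (q₁ ℕ.* d ℕ.* (q₁ ℕ.* d))     ≡⟨ cong (λ x → a ℕ.* (x ℕ.* x)) q₁d≡m ⟩
      a ℕ.* (m ℕ.* m)                     ≡⟨ eq ⟩
      n ℕ.* n                             ≡⟨ cong (λ x → x ℕ.* x) q₂d≡n ⟨
      q₂ ℕ.* d ℕ.* (q₂ ℕ.* d)             ≡⟨ ℕ.[m*n]*[o*p]≡[m*o]*[n*p] q₂ d q₂ d ⟩
      q₂ ℕ.* q₂ ℕ.* (d ℕ.* d)             ∎)
      where open ≡-Reasoning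
    q₁∣q₂² : q₁ ∣ q₂ ℕ.* q₂
    q₁∣q₂² = divides (a ℕ.* q₁) (trans (sym reduced) (sym (ℕ.*-assoc a q₁ q₁)))
    q₁≡1 : q₁ ≡ 1
    q₁≡1 = coprime-/gcd m n (ℕ.∣-refl , coprime-divisor (coprime-/gcd m n) q₁∣q₂²)
    a≡q₂² : a ≡ q₂ ℕ.* q₂
    a≡q₂² = trans (sym (ℕ.*-identityʳ a))
      (trans (cong (λ q → a ℕ.* (q ℕ.* q)) (sym q₁≡1)) reduced)

  ≈1⇒square : ∀ {a} → + a ≈ 1ℤ → IsSquare a
  ≈1⇒square {a} (square-ratio p q p≢0 q≢0 eq) =
    square-quotient a ∣ p ∣ ∣ q ∣ (λ ∣p∣≡0 → p≢0 (∣i∣≡0⇒i≡0 ∣p∣≡0)) (begin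
      a ℕ.* (∣ p ∣ ℕ.* ∣ p ∣)   ≡⟨ cong (a ℕ.*_) (abs-* p p) ⟨
      a ℕ.* ∣ p * p ∣           ≡⟨ abs-* (+ a) (p * p) ⟨
      ∣ + a * (p * p) ∣         ≡⟨ cong ∣_∣ (trans eq (*-identityˡ (q * q))) ⟩
      ∣ q * q ∣                 ≡⟨ abs-* q q ⟩
      ∣ q ∣ ℕ.* ∣ q ∣           ∎)
    where open ≡-Reasoning

  0<⇒≢0 : ∀ {x} → 0ℤ < x → x ≢ 0ℤ
  0<⇒≢0 0<x refl = <-irrefl refl 0<x

  *-pos : ∀ {x y} → 0ℤ < x → 0ℤ < y → 0ℤ < x * y
  *-pos {+[1+ m ]} {+[1+ n ]} _ _ = +<+ ℕ.z<s
  *-pos {+ zero}        (+<+ ()) _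
  *-pos {+[1+ m ]} {+ zero} _ (+<+ ())

  square-pos : ∀ {x} → x ≢ 0ℤ → 0ℤ < x * x
  square-pos {+ zero} x≢0 = contradiction refl x≢0
  square-pos {+[1+ n ]} _ = +<+ ℕ.z<s
  square-pos { -[1+ n ]} _ = +<+ ℕ.z<s

  ^-pos : ∀ {x} n → 0ℤ < x → 0ℤ < x ^ n
  ^-pos zero    0<x = +<+ ℕ.z<s
  ^-pos (suc n) 0<x = *-pos 0<x (^-pos n 0<x)

  -- Orthogonal bases for diagonal forms

  form : ∀ {n} → Vec ℤ n → Vec ℤ n → Vec ℤ n → ℤ
  form []       []       []       = 0ℤ
  form (c ∷ cs) (x ∷ xs) (y ∷ ys) = c * x * y + form cs xs ys

  product : ∀ {n} → Vec ℤ n → ℤ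
  product = Vec.foldr′ _*_ 1ℤ

  form-scale : ∀ {n} a (c x y : Vec ℤ n) → form (Vec.map (a *_) c) x y ≡ a * form c x y
  form-scale a []       []       []       = sym (*-zeroʳ a)
  form-scale a (c ∷ cs) (x ∷ xs) (y ∷ ys) =
    trans (cong (_+_ (a * c * x * y)) (form-scale a cs xs ys)) (distribute a c x y (form cs xs ys))
    where
    distribute : ∀ a c x y f → a * c * x * y + a * f ≡ a * (c * x * y + f)
    distribute = solve-∀

  product-scale : ∀ {n} a (c : Vec ℤ n) → product (Vec.map (a *_) c) ≡ a ^ n * product c
  product-scale a []       = refl
  product-scale {suc n} a (c ∷ cs) =
    trans (cong (_*_ (a * c)) (product-scale a cs)) (*-interchange a c (a ^ n) (product cs))

  scale-pos : ∀ {n a} {c : Vec ℤ n} → 0ℤ < a → VAll.All (0ℤ <_) c →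
              VAll.All (0ℤ <_) (Vec.map (a *_) c)
  scale-pos 0<a 0<c = VAll.map⁺ (VAll.map (*-pos 0<a) 0<c)

  product-pos : ∀ {n} {c : Vec ℤ n} → VAll.All (0ℤ <_) c → 0ℤ < product c
  product-pos []          = +<+ ℕ.z<s
  product-pos (0<c ∷ 0<cs) = *-pos 0<c (product-pos 0<cs)

  scaled-square-nonneg : ∀ {c} x → 0ℤ < c → 0ℤ ≤ c * (x * x)
  scaled-square-nonneg {c} x 0<c with x ≟ 0ℤ
  ... | yes refl = ≤-reflexive (sym (*-zeroʳ c))
  ... | no x≢0   = <⇒≤ (*-pos 0<c (square-pos x≢0))

  -- A change of coordinates in which `s` times the form is diagonal again and `x` lies on the axis
  -- of `coord`: by `rest-null` its other coordinates are invisible to `c′`. The factor `s` avoids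
  -- denominators. A change of basis multiplies the discriminant by a square, which is what `disc`
  -- records.
  record Splitting {n} (c : Vec ℤ (suc n)) (x : Vec ℤ (suc n)) : Set where
    field
      s c₀  : ℤ
      c′    : Vec ℤ n
      0<s   : 0ℤ < s
      0<c₀  : 0ℤ < c₀
      0<c′  : VAll.All (0ℤ <_) c′
      coord : Vec ℤ (suc n) → ℤ
      rest  : Vec ℤ (suc n) → Vec ℤ n
      split : ∀ y z → s * form c y z ≡ c₀ * coord y * coord z + form c′ (rest y) (rest z)
      rest-null : ∀ z → form c′ (rest x) z ≡ 0ℤ
      disc  : s ^ suc n * product c ≈ c₀ * product c′

  module _ {n} {c x : ℤ} {cs xs : Vec ℤ (suc n)} (0<c : 0ℤ < c) (S : Splitting cs xs) where
    open Splitting S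

    -- Here the plane vector `(x , coord xs)` is zero and gives no direction to rotate to. All
    -- coordinates of the tail can go into `rest`, and the first axis is the one split off.
    split-null : x ≡ 0ℤ → coord xs ≡ 0ℤ → Splitting (c ∷ cs) (x ∷ xs)
    split-null x≡0 u≡0 = record
      { s = s ; c₀ = s * c ; c′ = c₀ ∷ c′
      ; 0<s = 0<s ; 0<c₀ = *-pos 0<s 0<c ; 0<c′ = 0<c₀ ∷ 0<c′
      ; coord = Vec.head
      ; rest = λ { (_ ∷ ys) → coord ys ∷ rest ys }
      ; split = λ { (y ∷ ys) (z ∷ zs) → trans (*-distribˡ-+ s (c * y * z) (form cs ys zs))
          (cong₂ _+_ (reassoc s c y z) (split ys zs)) }
      ; rest-null = λ { (z ∷ zs) → cong₂ _+_
          (trans (cong (λ t → c₀ * t * z) u≡0) (cong (_* z) (*-zeroʳ c₀))) (rest-null zs) }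
      ; disc = ≈-trans (≈-reflexive (regroup s c (s ^ suc n) (product cs)))
          (≈-*-congˡ (s * c) disc)
      }
      where
      reassoc : ∀ s c y z → s * (c * y * z) ≡ s * c * y * z
      reassoc = solve-∀
      regroup : ∀ s c t p → s * t * (c * p) ≡ s * c * (t * p)
      regroup = solve-∀

    private
      N : ℤ
      N = s * c * (x * x) + c₀ * (coord xs * coord xs)

    -- New coordinates in the plane of the first coordinate and coord: the
    -- components along and across the vector (x , coord xs), whose norm is N.
    split-rotate : 0ℤ < N → Splitting (c ∷ cs) (x ∷ xs)
    split-rotate 0<N = record
      { s = s * N ; c₀ = 1ℤ ; c′ = s * c * c₀ ∷ Vec.map (N *_) c′
      ; 0<s = *-pos 0<s 0<N ; 0<c₀ = +<+ ℕ.z<s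
      ; 0<c′ = *-pos (*-pos 0<s 0<c) 0<c₀ ∷ scale-pos 0<N 0<c′
      ; coord = λ { (y ∷ ys) → s * c * x * y + c₀ * coord xs * coord ys }
      ; rest = λ { (y ∷ ys) → coord xs * y - x * coord ys ∷ rest ys }
      ; split = λ { (y ∷ ys) (z ∷ zs) → rotated y ys z zs }
      ; rest-null = λ { (z ∷ zs) → trans
          (cong₂ _+_ (across x (coord xs) (s * c * c₀) z)
                     (trans (form-scale N c′ (rest xs) zs) (cong (N *_) (rest-null zs))))
          (trans (+-identityˡ (N * 0ℤ)) (*-zeroʳ N)) }
      ; disc = disc′
      }
      where
      across : ∀ x u d z → d * (u * x - x * u) * z ≡ 0ℤ
      across = solve-∀
      rotated : ∀ y ys z zs →
        s * N * (c * y * z + form cs ys zs) ≡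
        1ℤ * (s * c * x * y + c₀ * coord xs * coord ys) * (s * c * x * z + c₀ * coord xs * coord zs)
        + (s * c * c₀ * (coord xs * y - x * coord ys) * (coord xs * z - x * coord zs)
        + form (Vec.map (N *_) c′) (rest ys) (rest zs))
      rotated y ys z zs = begin
        s * N * (c * y * z + form cs ys zs)
          ≡⟨ expand s N (c * y * z) (form cs ys zs) ⟩
        N * (s * (c * y * z) + s * form cs ys zs)
          ≡⟨ cong (λ t → N * (s * (c * y * z) + t)) (split ys zs) ⟩
        N * (s * (c * y * z) + (c₀ * coord ys * coord zs + form c′ (rest ys) (rest zs)))
          ≡⟨ identity s c c₀ x (coord xs) y (coord ys) z (coord zs) (form c′ (rest ys) (rest zs)) ⟩
        along + (crossed + N * form c′ (rest ys) (rest zs))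
          ≡⟨ cong (λ t → along + (crossed + t)) (form-scale N c′ (rest ys) (rest zs)) ⟨
        along + (crossed + form (Vec.map (N *_) c′) (rest ys) (rest zs)) ∎
        where
        open ≡-Reasoning
        along crossed : ℤ
        along = 1ℤ * (s * c * x * y + c₀ * coord xs * coord ys)
                   * (s * c * x * z + c₀ * coord xs * coord zs)
        crossed = s * c * c₀ * (coord xs * y - x * coord ys) * (coord xs * z - x * coord zs)
        expand : ∀ s N a b → s * N * (a + b) ≡ N * (s * a + s * b)
        expand = solve-∀
        -- The polarised Brahmagupta identity for A x² + B u² with A = `s * c` and B = `c₀`.
        identity : ∀ s c c₀ x u y Y z Z f →
          (s * c * (x * x) + c₀ * (u * u)) * (s * (c * y * z) + (c₀ * Y * Z + f)) ≡
          1ℤ * (s * c * x * y + c₀ * u * Y) * (s * c * x * z + c₀ * u * Z)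
          + (s * c * c₀ * (u * y - x * Y) * (u * z - x * Z)
          + (s * c * (x * x) + c₀ * (u * u)) * f)
        identity = solve-∀
      -- Of the `n + 2` factors `N`, two make a square and the other `n` are absorbed by the scaling
      -- of `c′`.
      disc′ : (s * N) ^ suc (suc n) * (c * product cs) ≈
              1ℤ * (s * c * c₀ * product (Vec.map (N *_) c′))
      disc′ = begin
        (s * N) ^ suc (suc n) * (c * product cs)
          ≡⟨ cong (_* (c * product cs)) (^-distribʳ-* s N (suc (suc n))) ⟩
        s * (s ^ suc n) * (N * (N * N ^ n)) * (c * product cs)
          ≡⟨ regroup s (s ^ suc n) N (N ^ n) c (product cs) ⟩
        s * c * N ^ n * (s ^ suc n * product cs) * (N * N)
          ≈⟨ ≈-square-factor _ (0<⇒≢0 0<N) ⟩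
        s * c * N ^ n * (s ^ suc n * product cs)
          ≈⟨ ≈-*-congˡ (s * c * N ^ n) disc ⟩
        s * c * N ^ n * (c₀ * product c′)
          ≡⟨ regroup′ s c (N ^ n) c₀ (product c′) ⟩
        1ℤ * (s * c * c₀ * (N ^ n * product c′))
          ≡⟨ cong (λ t → 1ℤ * (s * c * c₀ * t)) (product-scale N c′) ⟨
        1ℤ * (s * c * c₀ * product (Vec.map (N *_) c′)) ∎
        where
        open ≈-Reasoning
        regroup : ∀ s t N m c p → s * t * (N * (N * m)) * (c * p) ≡ s * c * m * (t * p) * (N * N)
        regroup = solve-∀
        regroup′ : ∀ s c m d p → s * c * m * (d * p) ≡ 1ℤ * (s * c * d * (m * p))
        regroup′ = solve-∀

  -- Induction on the dimension: once the tail is split, only the plane of the first axis and the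
  -- tail's `coord` remains to be rotated. Since the coefficients are positive, the norm in this
  -- plane is positive unless both coordinates vanish.
  split-off : ∀ {n} (c : Vec ℤ (suc n)) → VAll.All (0ℤ <_) c → ∀ x → Splitting c x
  split-off (c ∷ []) (0<c ∷ []) x = record
    { s = 1ℤ ; c₀ = c ; c′ = []
    ; 0<s = +<+ ℕ.z<s ; 0<c₀ = 0<c ; 0<c′ = []
    ; coord = Vec.head ; rest = λ _ → []
    ; split = λ { (y ∷ []) (z ∷ []) → *-identityˡ (c * y * z + 0ℤ) }
    ; rest-null = λ { [] → refl }
    ; disc = ≈-reflexive (*-identityˡ (c * 1ℤ))
    }
  split-off (c ∷ cs@(_ ∷ _)) (0<c ∷ 0<cs) (x ∷ xs) with split-off cs 0<cs xs
  ... | S with x ≟ 0ℤ | Splitting.coord S xs ≟ 0ℤ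
  ...   | yes x≡0 | yes u≡0 = split-null 0<c S x≡0 u≡0
  ...   | no x≢0  | _       = split-rotate 0<c S
    (+-mono-<-≤ (*-pos (*-pos 0<s 0<c) (square-pos x≢0)) (scaled-square-nonneg (coord xs) 0<c₀))
    where open Splitting S
  ...   | yes _   | no u≢0  = split-rotate 0<c S
    (+-mono-≤-< (scaled-square-nonneg x (*-pos 0<s 0<c)) (*-pos 0<c₀ (square-pos u≢0)))
    where open Splitting S

  norms : ∀ {n} → Vec ℤ n → List (Vec ℤ n) → ℤ
  norms c = List.foldr (λ x → form c x x *_) 1ℤ

  module _ {n} {c x : Vec ℤ (suc n)} (S : Splitting c x) where
    open Splitting S

    norms-split : ∀ {ys} → All (λ y → coord y ≡ 0ℤ) ys →
                  norms c′ (map rest ys) ≡ s ^ length ys * norms c ys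
    norms-split []                    = refl
    norms-split {y ∷ ys} (eq ∷ eqs) = trans
      (cong₂ _*_ (sym rest-norm) (norms-split eqs))
      (*-interchange s (form c y y) (s ^ length ys) (norms c ys))
      where
      rest-norm : s * form c y y ≡ form c′ (rest y) (rest y)
      rest-norm = trans (split y y) (trans
        (cong (_+ form c′ (rest y) (rest y))
          (trans (cong (_*_ (c₀ * coord y)) eq) (*-zeroʳ (c₀ * coord y))))
        (+-identityˡ _))

  module _ {n} {c x : Vec ℤ (suc n)} (S : Splitting c x) (0<xx : 0ℤ < form c x x) where
    open Splitting S

    -- `rest x` is null, so pairing with `x` sees only `coord`. As `coord x` turns out nonzero,
    -- vectors orthogonal to `x` have `coord` zero and live entirely in `rest`.
    split-self : ∀ y → s * form c x y ≡ c₀ * coord x * coord y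
    split-self y = trans (split x y)
      (trans (cong (_+_ (c₀ * coord x * coord y)) (rest-null (rest y))) (+-identityʳ _))

    coord-self≢0 : coord x ≢ 0ℤ
    coord-self≢0 u≡0 = 0<⇒≢0 (*-pos 0<s 0<xx) (trans (split-self x)
      (trans (cong (_*_ (c₀ * coord x)) u≡0) (*-zeroʳ (c₀ * coord x))))

    coord-orthogonal : ∀ {y} → form c x y ≡ 0ℤ → coord y ≡ 0ℤ
    coord-orthogonal {y} xy≡0 with i*j≡0⇒i≡0∨j≡0 (c₀ * coord x)
      (trans (sym (split-self y)) (trans (cong (s *_) xy≡0) (*-zeroʳ s)))
    ... | inj₁ c₀u≡0 = contradiction c₀u≡0 (*-≢0 (0<⇒≢0 0<c₀) coord-self≢0)
    ... | inj₂ eq    = eq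

    rest-form : ∀ {y} z → form c x y ≡ 0ℤ → s * form c y z ≡ form c′ (rest y) (rest z)
    rest-form {y} z xy≡0 = trans (split y z) (trans
      (cong (_+ form c′ (rest y) (rest z))
        (cong (_* coord z) (trans (cong (c₀ *_) (coord-orthogonal xy≡0)) (*-zeroʳ c₀))))
      (+-identityˡ _))

  Orthogonal : ∀ {n} → Vec ℤ n → Vec ℤ n → Vec ℤ n → Set
  Orthogonal c x y = form c x y ≡ 0ℤ

  -- In terms of determinants: if X has rows `xs`, then X diag(c) Xᵀ is diagonal, and its
  -- determinant is `norms c xs` as well as `product c` times (det X)². The induction splits off the
  -- head; the rests of the other vectors are an orthogonal basis for `c′` in one dimension less.
  orthogonal-basis-norms : ∀ {n} (c : Vec ℤ n) → VAll.All (0ℤ <_) c → ∀ xs → length xs ≡ n →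
    All (λ x → 0ℤ < form c x x) xs → AllPairs (Orthogonal c) xs → product c * norms c xs ≈ 1ℤ
  orthogonal-basis-norms [] [] [] refl [] [] = ≈-reflexive refl
  orthogonal-basis-norms {suc n} c 0<c (x ∷ xs) len (0<xx ∷ 0<xs) (x⊥xs ∷ xs⊥xs) = begin
    P * (D * M)
      -- This square supplies `s ^ suc n` for `disc`, `s` for `split-self` and `s ^ n` for
      -- `rest-basis`. Of the two factors `P′`, one is for `rest-basis` and one completes the square
      -- at the end.
      ≈⟨ ≈-square-factor (P * (D * M)) (*-≢0 P′≢0 s^≢0) ⟨
    P * (D * M) * (P′ * s ^ suc n * (P′ * s ^ suc n))
      ≡⟨ regroup P D M P′ s (s ^ n) ⟩
    (s ^ suc n * P) * ((s * D) * ((P′ * (s ^ n * M)) * P′))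
      ≡⟨ cong (λ t → (s ^ suc n * P) * (t * ((P′ * (s ^ n * M)) * P′))) (split-self S 0<xx x) ⟩
    (s ^ suc n * P) * ((c₀ * u * u) * ((P′ * (s ^ n * M)) * P′))
      ≈⟨ ≈-*-cong disc (≈-*-congˡ (c₀ * u * u) (≈-*-cong rest-basis (≈-refl P′))) ⟩
    (c₀ * P′) * ((c₀ * u * u) * (1ℤ * P′))
      ≡⟨ regroup′ c₀ P′ u ⟩
    1ℤ * (P′ * (c₀ * u) * (P′ * (c₀ * u)))
      ≈⟨ ≈-square-factor 1ℤ (*-≢0 P′≢0 (*-≢0 (0<⇒≢0 0<c₀) (coord-self≢0 S 0<xx))) ⟩
    1ℤ ∎
    where
    S = split-off c 0<c x
    open Splitting S
    P = product c
    P′ = product c′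
    D = form c x x
    M = norms c xs
    u = coord x
    P′≢0 = 0<⇒≢0 (product-pos 0<c′)
    s^≢0 = 0<⇒≢0 (^-pos (suc n) 0<s)
    len′ = ℕ.suc-injective len

    rest-pos : ∀ {ys} → All (Orthogonal c x) ys → All (λ y → 0ℤ < form c y y) ys →
               All (λ y → 0ℤ < form c′ y y) (map rest ys)
    rest-pos []             []             = []
    rest-pos {y ∷ _} (x⊥y ∷ x⊥ys) (0<yy ∷ 0<ys) =
      subst (0ℤ <_) (rest-form S 0<xx y x⊥y) (*-pos 0<s 0<yy) ∷ rest-pos x⊥ys 0<ys

    rest-orthogonal : ∀ {ys} → All (Orthogonal c x) ys → AllPairs (Orthogonal c) ys →
                      AllPairs (Orthogonal c′) (map rest ys)
    rest-orthogonal []           []           = []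
    rest-orthogonal (x⊥y ∷ x⊥ys) (y⊥ys ∷ ys⊥ys) =
      All.map⁺ (All.map (λ {z} y⊥z → trans (sym (rest-form S 0<xx z x⊥y))
                                           (trans (cong (s *_) y⊥z) (*-zeroʳ s))) y⊥ys)
      ∷ rest-orthogonal x⊥ys ys⊥ys

    rest-basis : P′ * (s ^ n * M) ≈ 1ℤ
    rest-basis = subst (λ t → P′ * t ≈ 1ℤ)
      (trans (norms-split S (All.map (coord-orthogonal S 0<xx) x⊥xs))
             (cong (λ m → s ^ m * M) len′))
      (orthogonal-basis-norms c′ 0<c′ (map rest xs) (trans (length-map rest xs) len′)
        (rest-pos x⊥xs 0<xs) (rest-orthogonal x⊥xs xs⊥xs))

    regroup : ∀ P D M P′ s t → P * (D * M) * (P′ * (s * t) * (P′ * (s * t))) ≡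
                               ((s * t) * P) * ((s * D) * ((P′ * (t * M)) * P′))
    regroup = solve-∀
    regroup′ : ∀ c p u → (c * p) * ((c * u * u) * (1ℤ * p)) ≡ 1ℤ * (p * (c * u) * (p * (c * u)))
    regroup′ = solve-∀
    open ≈-Reasoning

  -- Helmert contrasts

  total : ∀ {n} → List (Vec ℤ n) → Vec ℤ n
  total {n} = List.foldr (Vec.zipWith _+_) (Vec.replicate n 0ℤ)

  subtract : ∀ {n} → ℤ → Vec ℤ n → Vec ℤ n → Vec ℤ n
  subtract l = Vec.zipWith (λ x y → x - l * y)

  form-comm : ∀ {n} (c x y : Vec ℤ n) → form c x y ≡ form c y x
  form-comm []       []       []       = refl
  form-comm (c ∷ cs) (x ∷ xs) (y ∷ ys) = cong₂ _+_ (swap c x y) (form-comm cs xs ys)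
    where
    swap : ∀ c x y → c * x * y ≡ c * y * x
    swap = solve-∀

  form-zero : ∀ {n} (c x : Vec ℤ n) → form c x (Vec.replicate n 0ℤ) ≡ 0ℤ
  form-zero []       []       = refl
  form-zero (c ∷ cs) (x ∷ xs) = cong₂ _+_ (*-zeroʳ (c * x)) (form-zero cs xs)

  form-add : ∀ {n} (c x y z : Vec ℤ n) → form c x (Vec.zipWith _+_ y z) ≡ form c x y + form c x z
  form-add []       []       []       []       = refl
  form-add (c ∷ cs) (x ∷ xs) (y ∷ ys) (z ∷ zs) =
    trans (cong (_+_ (c * x * (y + z))) (form-add cs xs ys zs))
          (regroup c x y z (form cs xs ys) (form cs xs zs))
    where
    regroup : ∀ c x y z a b → c * x * (y + z) + (a + b) ≡ c * x * y + a + (c * x * z + b)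
    regroup = solve-∀

  form-subtract : ∀ {n} (c x : Vec ℤ n) l y z →
    form c x (subtract l y z) ≡ form c x y - l * form c x z
  form-subtract []       []       l []       []       = zero-case l
    where
    zero-case : ∀ l → 0ℤ ≡ 0ℤ - l * 0ℤ
    zero-case = solve-∀
  form-subtract (c ∷ cs) (x ∷ xs) l (y ∷ ys) (z ∷ zs) =
    trans (cong (_+_ (c * x * (y - l * z))) (form-subtract cs xs l ys zs))
          (regroup c x l y z (form cs xs ys) (form cs xs zs))
    where
    regroup : ∀ c x l y z a b →
      c * x * (y - l * z) + (a - l * b) ≡ c * x * y + a - l * (c * x * z + b)
    regroup = solve-∀

  contrast : ∀ {n} → Vec ℤ n → List (Vec ℤ n) → Vec ℤ n
  contrast u us = subtract (+ length us) (total us) u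

  -- Helmert's contrasts: together with total they orthogonalise a list of
  -- vectors whose pairwise products agree, such as a list of parallel lines.
  helmert : ∀ {n} → List (Vec ℤ n) → List (Vec ℤ n)
  helmert []               = []
  helmert (u ∷ [])         = []
  helmert (u ∷ us@(_ ∷ _)) = contrast u us ∷ helmert us

  length-helmert : ∀ {n} (u : Vec ℤ n) us → length (helmert (u ∷ us)) ≡ length us
  length-helmert u []         = refl
  length-helmert u (u′ ∷ us)  = cong suc (length-helmert u′ us)

  -- The Gram matrix is δI + βJ with J the all-ones matrix. A parallel class has β = 0; the class
  -- sums will have β = k² and δ = k e.
  record Uniform {n} (c : Vec ℤ n) (β δ : ℤ) (us : List (Vec ℤ n)) : Set where
    constructor uniform
    field
      norm-const : All (λ u → form c u u ≡ β + δ) us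
      pair-const : AllPairs (λ u v → form c u v ≡ β) us

  module _ {n} (c : Vec ℤ n) where

    form-total-const : ∀ {w γ us} → All (λ u → form c w u ≡ γ) us →
                       form c w (total us) ≡ + length us * γ
    form-total-const {w} {γ} [] = trans (form-zero c w) (sym (*-zeroˡ γ))
    form-total-const {w} {γ} {u ∷ us} (eq ∷ eqs) =
      trans (form-add c w u (total us))
        (trans (cong₂ _+_ eq (form-total-const eqs)) (factor γ (+ length us)))
      where
      factor : ∀ γ l → γ + l * γ ≡ (1ℤ + l) * γ
      factor = solve-∀

    -- The coefficients of a contrast, 1 for each member of `us` and minus `length us` for `u`, add
    -- up to zero.
    form-contrast-const : ∀ {w γ u us} → form c w u ≡ γ → All (λ v → form c w v ≡ γ) us →
                          form c w (contrast u us) ≡ 0ℤ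
    form-contrast-const {w} {γ} {u} {us} eq eqs =
      trans (form-subtract c w (+ length us) (total us) u)
        (trans (cong₂ (λ a b → a - + length us * b) (form-total-const eqs) eq)
               (+-inverseʳ (+ length us * γ)))

    form-helmert-const : ∀ {w γ us} → All (λ u → form c w u ≡ γ) us →
                         All (λ h → form c w h ≡ 0ℤ) (helmert us)
    form-helmert-const []                   = []
    form-helmert-const (_ ∷ [])             = []
    form-helmert-const (eq ∷ eqs@(_ ∷ _)) = form-contrast-const eq eqs ∷ form-helmert-const eqs

    module _ {β δ : ℤ} where

      -- The value is the common row sum of the Gram matrix δI + βJ.
      uniform-total : ∀ {us} → Uniform c β δ us →
                      All (λ v → form c (total us) v ≡ δ + + length us * β) us
      uniform-total {[]} (uniform [] []) = []
      uniform-total {u ∷ us} (uniform (uu ∷ norm) (uv ∷ pairs)) =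
        trans (form-comm c (total (u ∷ us)) u)
          (trans (form-add c u u (total us))
            (trans (cong₂ _+_ uu (form-total-const uv)) (regroup β δ (+ length us))))
        ∷ All.zipWith (λ {v} (eq , eq′) →
            trans (form-comm c (total (u ∷ us)) v)
              (trans (form-add c v u (total us))
                (trans (cong₂ _+_ (trans (form-comm c v u) eq) (trans (form-comm c v (total us)) eq′))
                  (regroup′ β δ (+ length us)))))
            (uv , uniform-total (uniform norm pairs))
        where
        regroup : ∀ β δ l → β + δ + l * β ≡ δ + (1ℤ + l) * β
        regroup = solve-∀
        regroup′ : ∀ β δ l → β + (δ + l * β) ≡ δ + (1ℤ + l) * β
        regroup′ = solve-∀

      total-norm : ∀ {us} → Uniform c β δ us →
                   form c (total us) (total us) ≡ + length us * (δ + + length us * β)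
      total-norm U = form-total-const (uniform-total U)

      contrast-self : ∀ {u us} → Uniform c β δ (u ∷ us) →
                      form c (contrast u us) u ≡ - (+ length us * δ)
      contrast-self {u} {us} (uniform (uu ∷ _) (uv ∷ _)) =
        trans (form-comm c (contrast u us) u)
          (trans (form-subtract c u (+ length us) (total us) u)
            (trans (cong₂ (λ a b → a - + length us * b) (form-total-const uv) uu)
              (cancel β δ (+ length us))))
        where
        cancel : ∀ β δ l → l * β - l * (β + δ) ≡ - (l * δ)
        cancel = solve-∀

      -- From the row sum of `us` one subtracts `length us` times β, which leaves δ. That this is
      -- constant on `us` makes all later contrasts orthogonal to the present one.
      contrast-later : ∀ {u us} → Uniform c β δ (u ∷ us) →
                       All (λ v → form c (contrast u us) v ≡ δ) us
      contrast-later {u} {us} (uniform (_ ∷ norm) (uv ∷ pairs)) =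
        All.zipWith (λ {v} (eq , eq′) →
          trans (form-comm c (contrast u us) v)
            (trans (form-subtract c v (+ length us) (total us) u)
              (trans (cong₂ (λ a b → a - + length us * b)
                       (trans (form-comm c v (total us)) eq′) (trans (form-comm c v u) eq))
                (cancel β δ (+ length us)))))
          (uv , uniform-total (uniform norm pairs))
        where
        cancel : ∀ β δ l → δ + l * β - l * β ≡ δ
        cancel = solve-∀

      contrast-norm : ∀ {u us} → Uniform c β δ (u ∷ us) →
                      form c (contrast u us) (contrast u us) ≡ + length us * (1ℤ + + length us) * δ
      contrast-norm {u} {us} U =
        trans (form-subtract c (contrast u us) (+ length us) (total us) u)
          (trans (cong₂ (λ a b → a - + length us * b) (form-total-const (contrast-later U))
                                                    (contrast-self U))
            (regroup δ (+ length us)))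
        where
        regroup : ∀ δ l → l * δ - l * (- (l * δ)) ≡ l * (1ℤ + l) * δ
        regroup = solve-∀

      uniform-tail : ∀ {u us} → Uniform c β δ (u ∷ us) → Uniform c β δ us
      uniform-tail (uniform (_ ∷ norm) (_ ∷ pairs)) = uniform norm pairs

      helmert-orthogonal : ∀ {us} → Uniform c β δ us → AllPairs (Orthogonal c) (helmert us)
      helmert-orthogonal {[]}         _ = []
      helmert-orthogonal {_ ∷ []}     _ = []
      helmert-orthogonal {_ ∷ _ ∷ _}  U =
        form-helmert-const (contrast-later U) ∷ helmert-orthogonal (uniform-tail U)

      total-helmert : ∀ {us} → Uniform c β δ us → All (Orthogonal c (total us)) (helmert us)
      total-helmert U = form-helmert-const (uniform-total U)

      helmert-pos : 0ℤ < δ → ∀ {us} → Uniform c β δ us → All (λ h → 0ℤ < form c h h) (helmert us)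
      helmert-pos 0<δ {[]}         _ = []
      helmert-pos 0<δ {_ ∷ []}     _ = []
      helmert-pos 0<δ {_ ∷ us@(_ ∷ _)} U =
        subst (0ℤ <_) (sym (contrast-norm U))
          (*-pos (*-pos {+ length us} {1ℤ + + length us} (+<+ ℕ.z<s) (+<+ ℕ.z<s)) 0<δ)
        ∷ helmert-pos 0<δ (uniform-tail U)

      -- The norms are l (l + 1) δ for l from 1 to `length us`. In their product every intermediate
      -- l occurs twice, so modulo squares it telescopes to the last l + 1.
      helmert-norms : ∀ {u us} → Uniform c β δ (u ∷ us) →
                      norms c (helmert (u ∷ us)) ≈ δ ^ length us * + length (u ∷ us)
      helmert-norms {us = []}      _ = ≈-refl 1ℤ
      helmert-norms {u} {us@(v ∷ vs)} U = begin
        form c (contrast u us) (contrast u us) * norms c (helmert us)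
          ≡⟨ cong (_* norms c (helmert us)) (contrast-norm U) ⟩
        L * (1ℤ + L) * δ * norms c (helmert us)
          ≈⟨ ≈-*-congˡ (L * (1ℤ + L) * δ) (helmert-norms (uniform-tail U)) ⟩
        L * (1ℤ + L) * δ * (δ ^ length vs * L)
          ≡⟨ regroup L δ (δ ^ length vs) ⟩
        δ * δ ^ length vs * (1ℤ + L) * (L * L)
          ≈⟨ ≈-square-factor _ {t = L} (λ ()) ⟩
        δ * δ ^ length vs * (1ℤ + L) ∎
        where
        open ≈-Reasoning
        L = + length us
        regroup : ∀ l δ t → l * (1ℤ + l) * δ * (t * l) ≡ δ * t * (1ℤ + l) * (l * l)
        regroup = solve-∀

  -- An orthogonal basis from blocks of vectors

  all-from-pairs : ∀ {A : Set} {R : A → A → Set} {xs} → (∀ {x y} → R x y → R y x) →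
                   All (λ x → R x x) xs → AllPairs R xs → All (λ x → All (R x) xs) xs
  all-from-pairs R-sym []       []             = []
  all-from-pairs R-sym (d ∷ ds) (rs ∷ pairs) =
    (d ∷ rs) ∷ All.zipWith (λ (r , rest) → R-sym r ∷ rest) (rs , all-from-pairs R-sym ds pairs)

  norms-++ : ∀ {n} (c : Vec ℤ n) xs ys → norms c (xs ++ ys) ≡ norms c xs * norms c ys
  norms-++ c []       ys = sym (*-identityˡ (norms c ys))
  norms-++ c (x ∷ xs) ys = trans (cong (form c x x *_) (norms-++ c xs ys))
                                 (sym (*-assoc (form c x x) (norms c xs) (norms c ys)))

  norms-concat : ∀ {n} (c : Vec ℤ n) {d xss} → All (λ xs → norms c xs ≈ d) xss →
                 norms c (concat xss) ≈ d ^ length xss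
  norms-concat c []         = ≈-refl 1ℤ
  norms-concat c {xss = xs ∷ xss} (eq ∷ eqs) =
    ≈-trans (≈-reflexive (norms-++ c xs (concat xss))) (≈-*-cong eq (norms-concat c eqs))

  length-concat : ∀ {A : Set} {l} {xss : List (List A)} → All (λ xs → length xs ≡ l) xss →
                  length (concat xss) ≡ length xss ℕ.* l
  length-concat [] = refl
  length-concat {xss = xs ∷ xss} (eq ∷ eqs) =
    trans (length-++ xs) (cong₂ ℕ._+_ eq (length-concat eqs))

  module _ {n} (c : Vec ℤ n) where

    Meeting : List (Vec ℤ n) → List (Vec ℤ n) → Set
    Meeting us ws = All (λ u → All (λ w → form c u w ≡ 1ℤ) ws) us

    Meeting-sym : ∀ {us ws} → Meeting us ws → Meeting ws us
    Meeting-sym M = All.map (All.map λ {u} eq → trans (form-comm c _ u) eq) (All.All-swap M)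

    OrthogonalTo : List (Vec ℤ n) → List (Vec ℤ n) → Set
    OrthogonalTo us ws = All (λ u → All (Orthogonal c u) ws) us

    -- Every member of `ws` has the constant product 1 with `us`, and contrasts annihilate
    -- constants.
    helmert-meeting : ∀ {us ws} → Meeting us ws → OrthogonalTo (helmert us) ws
    helmert-meeting M = All.All-swap (All.map
      (λ {w} eqs → All.map (λ {h} eq → trans (form-comm c h w) eq) (form-helmert-const c eqs))
      (Meeting-sym M))

    helmert-helmert : ∀ {us ws} → Meeting us ws → OrthogonalTo (helmert us) (helmert ws)
    helmert-helmert M = All.map (form-helmert-const c) (helmert-meeting M)

    helmert-total : ∀ {us ws} → Meeting us ws → All (λ h → Orthogonal c h (total ws)) (helmert us)
    helmert-total {ws = ws} M = All.map
      (λ eqs → trans (form-total-const c eqs) (*-zeroʳ (+ length ws))) (helmert-meeting M)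

    total-total : ∀ {us ws} → Meeting us ws →
                  form c (total us) (total ws) ≡ + length ws * + length us
    total-total {us} M = form-total-const c (All.map
      (λ {w} eqs → trans (form-comm c (total us) w)
        (trans (form-total-const c eqs) (*-identityʳ (+ length us))))
      (Meeting-sym M))

    module _ {a e : ℤ} {k′ j : ℕ} (0<a : 0ℤ < a) (0<e : 0ℤ < e) where
      private
        k m : ℕ
        k = suc k′
        m = suc j

      -- For a configuration, `a` will be the line size r, `k` the size of the parallel classes and
      -- `m` their number. With v = m k and r = k + e, the second equation is r² + k = v + r.
      module _ (a≡k+e : a ≡ + k + e) (a²≡e+mk : a * a ≡ e + + m * + k)
               {blocks : List (List (Vec ℤ n))}
               (sizes : All (λ us → length us ≡ k) blocks)
               (uniforms : All (Uniform c 0ℤ a) blocks)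
               (meeting : AllPairs Meeting blocks)
               (number : length blocks ≡ m) where
        private
          -- The basis `rows` consists of m (k - 1) contrasts within blocks, m - 1 contrasts between
          -- block sums, and the sum of everything: m k vectors.
          contrasts totals rows : List (Vec ℤ n)
          contrasts = concat (map helmert blocks)
          totals = map total blocks
          rows = contrasts ++ helmert totals ++ total totals ∷ []

        -- A block sum has norm k a = k² + k e; the product of two different block sums collects k²
        -- products equal to 1.
        totals-uniform : Uniform c (+ k * + k) (+ k * e) totals
        totals-uniform = uniform
          (All.map⁺ (All.zipWith (λ {us} (size , U) → trans (total-norm c U)
            (trans (cong (λ l → + l * (a + + l * 0ℤ)) size)
              (trans (cong (λ t → + k * (t + + k * 0ℤ)) a≡k+e) (expand (+ k) e))))
            (sizes , uniforms)))
          (AllPairs.map⁺ (go sizes meeting))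
          where
          expand : ∀ k e → k * (k + e + k * 0ℤ) ≡ k * k + k * e
          expand = solve-∀
          go : ∀ {uss} → All (λ us → length us ≡ k) uss → AllPairs Meeting uss →
               AllPairs (λ us ws → form c (total us) (total ws) ≡ + k * + k) uss
          go []           []          = []
          go (size ∷ sizes) (M ∷ Ms) =
            All.zipWith (λ (size′ , M) → trans (total-total M)
              (cong₂ (λ x y → + x * + y) size′ size)) (sizes , M)
            ∷ go sizes Ms

        -- The sum of the contrast's own block has constant products with that block, by
        -- `uniform-total`; for any other block `helmert-total` applies.
        contrasts⊥totals : OrthogonalTo contrasts totals
        contrasts⊥totals = All.concat⁺ (All.map⁺ (All.map
          (λ rs → All.map All.map⁺ (All.All-swap (All.map proj₁ rs)))
          -- Orthogonality is taken in both directions at once, which makes the relation between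
          -- blocks symmetric.
          (all-from-pairs (λ (p , q) → q , p)
            (All.map (λ {us} U → let h⊥ = All.map (λ {h} eq → trans (form-comm c h (total us)) eq)
                                              (total-helmert c U) in h⊥ , h⊥) uniforms)
            (AllPairs.map (λ M → helmert-total M , helmert-total (Meeting-sym M)) meeting))))

        rows-orthogonal : AllPairs (Orthogonal c) rows
        rows-orthogonal = AllPairs.++⁺
          (AllPairs.concat⁺ (All.map⁺ (All.map (helmert-orthogonal c) uniforms))
                            (AllPairs.map⁺ (AllPairs.map helmert-helmert meeting)))
          (AllPairs.++⁺ (helmert-orthogonal c totals-uniform) ([] ∷ [])
            (All.map (λ {h} eq → trans (form-comm c h (total totals)) eq ∷ [])
                     (total-helmert c totals-uniform)))
          (All.map (λ eqs → All.++⁺ (form-helmert-const c eqs)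
                     (trans (form-total-const c eqs) (*-zeroʳ (+ length totals)) ∷ []))
                   contrasts⊥totals)

        length-totals : length totals ≡ m
        length-totals = trans (length-map total blocks) number

        0<ke : 0ℤ < + k * e
        0<ke = *-pos {+ k} (+<+ ℕ.z<s) 0<e

        -- The norm m (k e + m k²) is m k (e + m k), and the second factor is the square a².
        total-totals-norm : form c (total totals) (total totals) ≡ + m * + k * (a * a)
        total-totals-norm = trans (total-norm c totals-uniform)
          (trans (cong (λ l → + l * (+ k * e + + l * (+ k * + k))) length-totals)
            (trans (factor (+ m) (+ k) e) (cong (_*_ (+ m * + k)) (sym a²≡e+mk))))
          where
          factor : ∀ m k e → m * (k * e + m * (k * k)) ≡ m * k * (e + m * k)
          factor = solve-∀

        rows-pos : All (λ x → 0ℤ < form c x x) rows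
        rows-pos = All.++⁺ (All.concat⁺ (All.map⁺ (All.map (helmert-pos c 0<a) uniforms)))
          (All.++⁺ (helmert-pos c 0<ke totals-uniform)
            (subst (0ℤ <_) (sym total-totals-norm)
              (*-pos (*-pos {+ m} {+ k} (+<+ ℕ.z<s) (+<+ ℕ.z<s)) (*-pos 0<a 0<a)) ∷ []))

        length-helmert-suc : ∀ {l} (us : List (Vec ℤ n)) → length us ≡ suc l → length (helmert us) ≡ l
        length-helmert-suc (u ∷ us) eq = trans (length-helmert u us) (ℕ.suc-injective eq)

        length-rows : length rows ≡ m ℕ.* k
        length-rows = begin
          length rows
            ≡⟨ length-++ contrasts ⟩
          length contrasts ℕ.+ length (helmert totals ++ total totals ∷ [])
            ≡⟨ cong₂ ℕ._+_ (length-concat {l = k′}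
                                            (All.map⁺ (All.map (λ {us} → length-helmert-suc us) sizes)))
                           (length-++ (helmert totals)) ⟩
          length (map helmert blocks) ℕ.* k′ ℕ.+ (length (helmert totals) ℕ.+ 1)
            ≡⟨ cong₂ (λ x y → x ℕ.* k′ ℕ.+ (y ℕ.+ 1)) (trans (length-map helmert blocks) number)
                     (length-helmert-suc totals length-totals) ⟩
          m ℕ.* k′ ℕ.+ (j ℕ.+ 1)
            ≡⟨ cong (m ℕ.* k′ ℕ.+_) (ℕ.+-comm j 1) ⟩
          m ℕ.* k′ ℕ.+ m
            ≡⟨ ℕ.+-comm (m ℕ.* k′) m ⟩
          m ℕ.+ m ℕ.* k′
            ≡⟨ ℕ.*-suc m k′ ⟨
          m ℕ.* k ∎
          where open ≡-Reasoning

        helmert-norms-suc : ∀ {β δ l us} → Uniform c β δ us → length us ≡ suc l →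
                            norms c (helmert us) ≈ δ ^ l * + suc l
        helmert-norms-suc {δ = δ} {us = u ∷ us} U refl = helmert-norms c U

        -- The factor `m` arises twice, from the contrasts between the block sums and from the norm
        -- of the grand total, so it disappears modulo squares together with a².
        rows-norms : norms c rows ≈ (a ^ k′ * + k) ^ m * ((+ k * e) ^ j * + k)
        rows-norms = begin
          norms c rows
            ≡⟨ trans (norms-++ c contrasts _)
                     (cong (norms c contrasts *_) (norms-++ c (helmert totals) _)) ⟩
          norms c contrasts * (norms c (helmert totals) * (form c (total totals) (total totals) * 1ℤ))
            ≡⟨ cong (λ t → norms c contrasts * (norms c (helmert totals) * (t * 1ℤ)))
                    total-totals-norm ⟩
          norms c contrasts * (norms c (helmert totals) * (+ m * + k * (a * a) * 1ℤ))
            ≈⟨ ≈-*-cong contrasts-norms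
                 (≈-*-cong (helmert-norms-suc totals-uniform length-totals)
                           (≈-refl (+ m * + k * (a * a) * 1ℤ))) ⟩
          (a ^ k′ * + k) ^ m * ((+ k * e) ^ j * + m * (+ m * + k * (a * a) * 1ℤ))
            ≡⟨ regroup ((a ^ k′ * + k) ^ m) ((+ k * e) ^ j) (+ m) (+ k) a ⟩
          (a ^ k′ * + k) ^ m * ((+ k * e) ^ j * + k) * (+ m * a * (+ m * a))
            ≈⟨ ≈-square-factor _ {t = + m * a} (*-≢0 {+ m} (λ ()) (0<⇒≢0 0<a)) ⟩
          (a ^ k′ * + k) ^ m * ((+ k * e) ^ j * + k) ∎
          where
          contrasts-norms : norms c contrasts ≈ (a ^ k′ * + k) ^ m
          contrasts-norms = subst (λ l → norms c contrasts ≈ (a ^ k′ * + k) ^ l)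
            (trans (length-map helmert blocks) number)
            (norms-concat c (All.map⁺ (All.zipWith (λ (U , size) → helmert-norms-suc U size)
                                                   (uniforms , sizes))))
          regroup : ∀ x y m k a → x * (y * m * (m * k * (a * a) * 1ℤ)) ≡
                                  x * (y * k) * (m * a * (m * a))
          regroup = solve-∀
          open ≈-Reasoning

        -- With n = m k there are as many orthogonal `rows` as dimensions, so they are a basis.
        disc-blocks : VAll.All (0ℤ <_) c → n ≡ m ℕ.* k →
                      product c * ((a ^ k′ * + k) ^ m * ((+ k * e) ^ j * + k)) ≈ 1ℤ
        disc-blocks 0<c n≡mk = ≈-trans (≈-*-congˡ (product c) (≈-sym rows-norms))
          (orthogonal-basis-norms c 0<c rows (trans length-rows (sym n≡mk)) rows-pos rows-orthogonal)

  -- Incidence vectors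

  ones : ∀ n → Vec ℤ n
  ones n = Vec.replicate n 1ℤ

  ones-pos : ∀ n → VAll.All (0ℤ <_) (ones n)
  ones-pos zero    = []
  ones-pos (suc n) = +<+ ℕ.z<s ∷ ones-pos n

  product-ones : ∀ n → product (ones n) ≡ 1ℤ
  product-ones zero    = refl
  product-ones (suc n) = trans (*-identityˡ (product (ones n))) (product-ones n)

  bit : Bool → ℤ
  bit true  = 1ℤ
  bit false = 0ℤ

  indicator : ∀ {n} → Subset n → Vec ℤ n
  indicator = Vec.map bit

  form-indicator : ∀ {n} (p q : Subset n) → form (ones n) (indicator p) (indicator q) ≡ + size (p ∩ q)
  form-indicator []            []            = refl
  form-indicator (inside  ∷ p) (inside  ∷ q) = cong (_+_ 1ℤ) (form-indicator p q)
  form-indicator (inside  ∷ p) (outside ∷ q) = trans (+-identityˡ _) (form-indicator p q)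
  form-indicator (outside ∷ p) (_       ∷ q) = trans (+-identityˡ _) (form-indicator p q)

  form-indicator-const : ∀ {n} (p : Subset n) {x : Vec ℤ n} {r} → (∀ i → Vec.lookup x i ≡ r) →
                         form (ones n) (indicator p) x ≡ + size p * r
  form-indicator-const []            {[]}    {r} _  = sym (*-zeroˡ r)
  form-indicator-const (inside  ∷ p) {x ∷ _} {r} eq =
    trans (cong₂ _+_ (trans (*-identityˡ x) (eq Fin.zero)) (form-indicator-const p (eq ∘ Fin.suc)))
          (factor r (+ size p))
    where
    factor : ∀ r s → r + s * r ≡ (1ℤ + s) * r
    factor = solve-∀
  form-indicator-const (outside ∷ p) {_ ∷ _} eq =
    trans (+-identityˡ _) (form-indicator-const p (eq ∘ Fin.suc))

  size-∷ : ∀ {n} s (p : Subset n) → bit s + + size p ≡ + size (s ∷ p)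
  size-∷ inside  p = refl
  size-∷ outside p = refl

  total-indicators : ∀ {v b} (line : Fin b → Subset v) p →
    Vec.lookup (total (List.tabulate (indicator ∘ line))) p ≡ + size (linesOn line p)
  total-indicators {b = zero}  line p = lookup-replicate p 0ℤ
  total-indicators {b = suc _} line p =
    trans (lookup-zipWith _+_ p (indicator (line Fin.zero)) _)
      (trans (cong₂ _+_ (lookup-map p bit (line Fin.zero)) (total-indicators (line ∘ Fin.suc) p))
             (size-∷ (Vec.lookup (line Fin.zero) p) (linesOn (line ∘ Fin.suc) p)))

  size≡1 : ∀ {n} {p : Subset n} → Nonempty p → (∀ {x y} → x ∈ₛ p → y ∈ₛ p → x ≡ y) → size p ≡ 1
  size≡1 {p = p} (x , x∈p) unique = trans
    (cong size (⊆-antisym (λ {y} y∈p → subst (_∈ₛ ⁅ x ⁆) (unique x∈p y∈p) (x∈⁅x⁆ x))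
                          (λ {y} y∈⁅x⁆ → subst (_∈ₛ p) (sym (x∈⁅y⁆⇒x≡y x y∈⁅x⁆)) x∈p)))
    (∣⁅x⁆∣≡1 x)

  -- Parallel classes

  module _ {A : Set} {_~_ : A → A → Set} (_~?_ : Decidable _~_)
           (~-refl : ∀ {x} → x ~ x) (~-sym : ∀ {x y} → x ~ y → y ~ x)
           (~-trans : ∀ {x y z} → x ~ y → y ~ z → x ~ z) (k : ℕ) where

    class rest-of : A → List A → List A
    class x   = filter (x ~?_)
    rest-of x = filter (¬? ∘ (x ~?_))

    record Partition (xs : List A) : Set where
      field
        classes   : List (List A)
        contained : All (All (_∈ xs)) classes
        sizes     : All (λ B → length B ≡ k) classes
        -- Distinctness is recorded because `_~_` is reflexive: for lines, being related yields
        -- parallelism only when they differ.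
        related   : All (AllPairs (λ x y → x ≢ y × x ~ y)) classes
        separated : AllPairs (λ B C → All (λ x → All (λ y → ¬ x ~ y) C) B) classes
        count     : length xs ≡ length classes ℕ.* k

    length-split : ∀ x xs → length xs ≡ length (class x xs) ℕ.+ length (rest-of x xs)
    length-split x [] = refl
    length-split x (y ∷ ys) with x ~? y
    ... | yes _ = cong suc (length-split x ys)
    ... | no _  = trans (cong suc (length-split x ys)) (sym (ℕ.+-suc _ _))

    -- An element that is dropped for being related to `x` cannot be related to `y` too, as it would
    -- link `x` to `y`.
    class-rest : ∀ {x y} → ¬ x ~ y → ∀ zs → class y (rest-of x zs) ≡ class y zs
    class-rest {x} {y} x≁y [] = refl
    class-rest {x} {y} x≁y (z ∷ zs) with x ~? z
    ... | yes x~z = trans (class-rest x≁y zs)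
                      (sym (filter-reject (y ~?_) (λ y~z → x≁y (~-trans x~z (~-sym y~z)))))
    ... | no _ with y ~? z
    ...   | yes _ = cong (z ∷_) (class-rest x≁y zs)
    ...   | no _  = class-rest x≁y zs

    related-class : ∀ {x ys} → All (x ~_) ys → Unique ys → AllPairs (λ y z → y ≢ z × y ~ z) ys
    related-class []           []           = []
    related-class (x~y ∷ x~ys) (y∉ys ∷ ys!) =
      All.zipWith (λ (y≢z , x~z) → y≢z , ~-trans (~-sym x~y) x~z) (y∉ys , x~ys)
      ∷ related-class x~ys ys!

    -- Peels off the class of the head and recurses on the rest. The rest is a filtered list, not a
    -- structural sublist, so `bound` carries the recursion. The class sizes survive by
    -- `class-rest`.
    partition : ∀ bound xs → length xs ℕ.≤ bound → Unique xs →
                All (λ x → length (class x xs) ≡ k) xs → Partition xs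
    partition _ [] _ _ _ = record
      { classes = [] ; contained = [] ; sizes = [] ; related = [] ; separated = [] ; count = refl }
    partition (suc bound) (x ∷ xs) (ℕ.s≤s len) xs! class-sizes = record
      { classes   = class x (x ∷ xs) ∷ classes
      ; contained = All.tabulate (proj₁ ∘ ∈-filter⁻ (x ~?_))
                    ∷ All.map (All.map (proj₁ ∘ from-rest)) contained
      ; sizes     = All.head class-sizes ∷ sizes
      ; related   = related-class (All.all-filter (x ~?_) (x ∷ xs)) (Unique.filter⁺ (x ~?_) xs!)
                    ∷ related
      ; separated = All.map (λ C⊆rest → All.map
                        (λ x~y → All.map (λ z∈rest y~z → proj₂ (from-rest z∈rest) (~-trans x~y y~z))
                                         C⊆rest)
                        (All.all-filter (x ~?_) (x ∷ xs)))
                      contained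
                    ∷ separated
      ; count     = trans (length-split x (x ∷ xs)) (cong₂ ℕ._+_ (All.head class-sizes) count)
      }
      where
      from-rest : ∀ {z} → z ∈ rest-of x (x ∷ xs) → z ∈ x ∷ xs × ¬ x ~ z
      from-rest = ∈-filter⁻ (¬? ∘ (x ~?_))
      rest-bound : length (rest-of x (x ∷ xs)) ℕ.≤ bound
      -- By reflexivity the filter rejects `x` itself, so the rest is no longer than `xs`.
      rest-bound = subst (λ l → length l ℕ.≤ bound)
        (sym (filter-reject (¬? ∘ (x ~?_)) (λ x≁x → x≁x ~-refl)))
        (ℕ.≤-trans (length-filter _ xs) len)
      open Partition (partition bound (rest-of x (x ∷ xs)) rest-bound
        (Unique.filter⁺ (¬? ∘ (x ~?_)) xs!)
        (All.tabulate λ z∈rest → trans (cong length (class-rest (proj₂ (from-rest z∈rest)) (x ∷ xs)))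
                                       (All.lookup class-sizes (proj₁ (from-rest z∈rest)))))

  -- Counting parallel lines in a configuration

  module _ {v r} (C : Configuration v r) where
    open Configuration C

    point-row : Fin v → Vec ℤ v
    point-row l = indicator (line l)

    inner : Fin v → Fin v → ℤ
    inner l m = form (ones v) (point-row l) (point-row m)

    inner-self : ∀ l → inner l l ≡ + r
    inner-self l = trans (form-indicator (line l) (line l))
      (cong +_ (trans (cong size (∩-idem (line l))) (line-size l)))

    inner-parallel : ∀ {l m} → Parallel l m → inner l m ≡ 0ℤ
    inner-parallel {l} {m} l∥m = trans (form-indicator (line l) (line m))
      (cong +_ (trans (cong size (Empty-unique l∥m)) (∣⊥∣≡0 v)))

    inner-meeting : ∀ {l m} → l ≢ m → ¬ Parallel l m → inner l m ≡ 1ℤ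
    inner-meeting {l} {m} l≢m l∦m with nonempty? (line l ∩ line m)
    ... | no empty     = contradiction empty l∦m
    ... | yes nonempty = trans (form-indicator (line l) (line m)) (cong +_ (size≡1 nonempty unique))
      where
      unique : ∀ {p q} → p ∈ₛ line l ∩ line m → q ∈ₛ line l ∩ line m → p ≡ q
      unique {p} {q} p∈ q∈ with p Fin.≟ q
      ... | yes p≡q = p≡q
      ... | no p≢q  = contradiction
        (linear p≢q (proj₁ (x∈p∩q⁻ _ _ p∈)) (proj₁ (x∈p∩q⁻ _ _ q∈))
                    (proj₂ (x∈p∩q⁻ _ _ p∈)) (proj₂ (x∈p∩q⁻ _ _ q∈))) l≢m

    Parallel-sym : ∀ {l m} → Parallel l m → Parallel m l
    Parallel-sym {l} {m} = subst Empty (∩-comm (line l) (line m))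

    -- A nonempty line is not `Parallel` to itself; adding equality gives the relation that is an
    -- equivalence under TOPs.
    _∥_ : Fin v → Fin v → Set
    l ∥ m = l ≡ m ⊎ Parallel l m

    _∥?_ : Decidable _∥_
    l ∥? m = (l Fin.≟ m) ⊎-dec ¬? (nonempty? (line l ∩ line m))

    ∥-sym : ∀ {l m} → l ∥ m → m ∥ l
    ∥-sym (inj₁ l≡m) = inj₁ (sym l≡m)
    ∥-sym (inj₂ l∥m) = inj₂ (Parallel-sym l∥m)

    ∥-trans : TransitiveParallels C → ∀ {l m n} → l ∥ m → m ∥ n → l ∥ n
    ∥-trans tops (inj₁ refl) m∥n        = m∥n
    ∥-trans tops l∥m        (inj₁ refl) = l∥m
    ∥-trans tops {l} {m} {n} (inj₂ l∥m) (inj₂ m∥n) with l Fin.≟ m | m Fin.≟ n | l Fin.≟ n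
    ... | yes refl | _        | _       = inj₂ m∥n
    ... | no _     | yes refl | _       = inj₂ l∥m
    ... | no _     | no _     | yes l≡n = inj₁ l≡n
    ... | no l≢m   | no m≢n   | no l≢n  =
      -- TOPs is applied at the middle line `m`, which is parallel to both others.
      inj₂ (tops m l n (l≢m ∘ sym) m≢n l≢n (Parallel-sym l∥m) m∥n)

    lines : List (Fin v)
    lines = List.allFin v

    parallels : Fin v → List (Fin v) → ℤ
    parallels l ms = + length (filter (l ∥?_) ms)

    -- Counts the pairs of a point on `l` and a line of `ms` through that point.
    incidences : Fin v → List (Fin v) → ℤ
    incidences l ms = form (ones v) (point-row l) (total (map point-row ms))

    incidences-∷ : ∀ l m ms → incidences l (m ∷ ms) ≡ inner l m + incidences l ms
    incidences-∷ l m ms = form-add (ones v) (point-row l) (point-row m) (total (map point-row ms))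

    -- A line m ≠ l contributes 1 to exactly one of the two summands, while l
    -- itself contributes r to the first and 1 to the second.
    count-≢ : ∀ {l m} → l ≢ m → ∀ ms →
      incidences l (m ∷ ms) + parallels l (m ∷ ms) ≡ 1ℤ + (incidences l ms + parallels l ms)
    count-≢ {l} {m} l≢m ms with l ∥? m
    ... | yes (inj₁ l≡m) = contradiction l≡m l≢m
    ... | yes (inj₂ l∥m) = trans
      (cong₂ _+_ (trans (incidences-∷ l m ms) (cong (_+ incidences l ms) (inner-parallel l∥m)))
                 (cong (+_ ∘ length) (filter-accept (l ∥?_) (inj₂ l∥m))))
      (regroup (incidences l ms) (parallels l ms))
      where
      regroup : ∀ t p → 0ℤ + t + (1ℤ + p) ≡ 1ℤ + (t + p)
      regroup = solve-∀
    ... | no l∦m = trans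
      (cong₂ _+_ (trans (incidences-∷ l m ms)
                        (cong (_+ incidences l ms) (inner-meeting l≢m (l∦m ∘ inj₂))))
                 (cong (+_ ∘ length) (filter-reject (l ∥?_) l∦m)))
      (+-assoc 1ℤ (incidences l ms) (parallels l ms))

    count-∉ : ∀ {l ms} → All (l ≢_) ms → incidences l ms + parallels l ms ≡ + length ms
    count-∉ {l} [] = cong (_+ 0ℤ) (form-zero (ones v) (point-row l))
    count-∉ {ms = _ ∷ ms} (l≢m ∷ l∉ms) = trans (count-≢ l≢m ms) (cong (_+_ 1ℤ) (count-∉ l∉ms))

    count-∈ : ∀ {l ms} → Unique ms → l ∈ ms → incidences l ms + parallels l ms ≡ + length ms + + r
    count-∈ {l} {_ ∷ ms} (l∉ms ∷ _) (here refl) = trans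
      (cong₂ _+_ (trans (incidences-∷ l l ms) (cong (_+ incidences l ms) (inner-self l)))
                 (cong (+_ ∘ length) (filter-accept (l ∥?_) (inj₁ refl))))
      (trans (regroup (incidences l ms) (parallels l ms) (+ r))
             (cong (λ t → 1ℤ + t + + r) (count-∉ l∉ms)))
      where
      regroup : ∀ t p r → r + t + (1ℤ + p) ≡ 1ℤ + (t + p) + r
      regroup = solve-∀
    count-∈ {ms = _ ∷ ms} (m∉ms ∷ ms!) (there l∈ms) =
      trans (count-≢ (All.lookup m∉ms l∈ms ∘ sym) ms)
        (trans (cong (_+_ 1ℤ) (count-∈ ms! l∈ms)) (sym (+-assoc 1ℤ (+ length ms) (+ r))))

    -- Summation by points: each of the `r` points of `l` lies on `r` lines.
    incidences-lines : ∀ l → incidences l lines ≡ + r * + r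
    incidences-lines l = trans
      (form-indicator-const (line l) (λ p →
        trans (cong (λ xs → Vec.lookup (total xs) p) (map-tabulate (λ m → m) point-row))
          (trans (total-indicators line p) (cong +_ (point-degree p)))))
      (cong (λ s → + s * + r) (line-size l))

    -- Two evaluations of the same count. Every class thus has v + r - r² lines, which for v = n² +
    -- n + k and r = n + 1 is the deficiency k.
    class-count : ∀ l → r ℕ.* r ℕ.+ length (filter (l ∥?_) lines) ≡ v ℕ.+ r
    class-count l = +-injective (begin
      + (r ℕ.* r ℕ.+ length (filter (l ∥?_) lines))   ≡⟨ pos-+ (r ℕ.* r) _ ⟩
      + (r ℕ.* r) + parallels l lines                 ≡⟨ cong (_+ parallels l lines) (pos-* r r) ⟩
      + r * + r + parallels l lines
        ≡⟨ cong (_+ parallels l lines) (incidences-lines l) ⟨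
      incidences l lines + parallels l lines          ≡⟨ count-∈ (Unique.allFin⁺ v) (∈-allFin l) ⟩
      + length lines + + r
        ≡⟨ cong (λ n → + n + + r) (length-tabulate (λ m → m)) ⟩
      + v + + r ∎)
      where open ≡-Reasoning

    module _ (tops : TransitiveParallels C) {k′ : ℕ} (vr : v ℕ.+ r ≡ r ℕ.* r ℕ.+ suc k′) where

      private
        k : ℕ
        k = suc k′

      parallel-classes : Partition _∥?_ (inj₁ refl) ∥-sym (∥-trans tops) k lines
      parallel-classes = partition _∥?_ (inj₁ refl) ∥-sym (∥-trans tops) k (length lines) lines
        ℕ.≤-refl (Unique.allFin⁺ v)
        (All.tabulate (λ {l} _ → ℕ.+-cancelˡ-≡ (r ℕ.* r) _ _ (trans (class-count l) vr)))

      open Partition parallel-classes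

      number-of-classes : v ≡ length classes ℕ.* k
      number-of-classes = trans (sym (length-tabulate (λ m → m))) count

      class-size-divides : ∃ λ m → v ≡ m ℕ.* k
      class-size-divides = length classes , number-of-classes

      r-pos : ∀ {e} → r ≡ k ℕ.+ e → 0ℤ < + r
      r-pos r≡k+e = subst (λ r → 0ℤ < + r) (sym r≡k+e) (+<+ ℕ.z<s)

      module _ {j e : ℕ} (0<e : 0 ℕ.< e) (r≡k+e : r ≡ k ℕ.+ e) (v≡mk : v ≡ suc j ℕ.* k) where
        private
         m : ℕ
         m = suc j

        -- The block construction is used with the standard inner product, whose coefficients have
        -- product 1.
        configuration-disc : ((+ r) ^ k′ * + k) ^ m * ((+ k * + e) ^ j * + k) ≈ 1ℤ
        configuration-disc = subst (_≈ 1ℤ)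
          (trans (cong (_* X) (product-ones v)) (*-identityˡ X))
          (disc-blocks (ones v) (r-pos r≡k+e) (+<+ 0<e) (trans (cong +_ r≡k+e) (pos-+ k e)) r²≡e+mk
            (All.map⁺ (All.map (λ {B} → trans (length-map point-row B)) sizes))
            (All.map⁺ (All.map class-uniform related))
            (AllPairs.map⁺ (AllPairs.map (λ sep → All.map⁺ (All.map (λ s → All.map⁺ (All.map
              (λ l∦m → inner-meeting (l∦m ∘ inj₁) (l∦m ∘ inj₂)) s)) sep)) separated))
            (trans (length-map (map point-row) classes) number)
            (ones-pos v) v≡mk)
          where
          X : ℤ
          X = ((+ r) ^ k′ * + k) ^ m * ((+ k * + e) ^ j * + k)

          number : length classes ≡ m
          number = ℕ.*-cancelʳ-≡ _ _ k (trans (sym number-of-classes) v≡mk)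

          r²≡e+mk : + r * + r ≡ + e + + m * + k
          r²≡e+mk = trans (sym (pos-* r r)) (trans (cong +_ (ℕ.+-cancelʳ-≡ k _ _ (begin
            r ℕ.* r ℕ.+ k               ≡⟨ vr ⟨
            v ℕ.+ r                     ≡⟨ cong₂ ℕ._+_ v≡mk r≡k+e ⟩
            m ℕ.* k ℕ.+ (k ℕ.+ e)       ≡⟨ regroup (m ℕ.* k) k e ⟩
            e ℕ.+ m ℕ.* k ℕ.+ k         ∎)))
            (trans (pos-+ e (m ℕ.* k)) (cong (_+_ (+ e)) (pos-* m k))))
            where
            open ≡-Reasoning
            regroup : ∀ x k e → x ℕ.+ (k ℕ.+ e) ≡ e ℕ.+ x ℕ.+ k
            regroup = ℕ-solve-∀

          class-uniform : ∀ {ls} → AllPairs (λ l m → l ≢ m × l ∥ m) ls →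
                          Uniform (ones v) 0ℤ (+ r) (map point-row ls)
          class-uniform pairs = uniform
            (All.map⁺ (All.tabulate (λ {l} _ → inner-self l)))
            (AllPairs.map⁺ (AllPairs.map (λ where
              (l≢m , inj₁ l≡m) → contradiction l≡m l≢m
              (_   , inj₂ l∥m) → inner-parallel l∥m) pairs))

  -- Parity and the square class of the discriminant

  even-or-odd : ∀ j → ∃ (λ q → j ≡ q ℕ.* 2) ⊎ ∃ (λ q → j ≡ suc (q ℕ.* 2))
  even-or-odd zero    = inj₁ (0 , refl)
  even-or-odd (suc j) with even-or-odd j
  ... | inj₁ (q , refl) = inj₂ (q , refl)
  ... | inj₂ (q , refl) = inj₁ (suc q , refl)

  odd⇒2∤ : ∀ q → 2 ∤ suc (q ℕ.* 2)
  odd⇒2∤ q 2∣ with () ← ℕ.∣1⇒≡1 (ℕ.∣m+n∣m⇒∣n (subst (2 ∣_) (ℕ.+-comm 1 (q ℕ.* 2)) 2∣) (ℕ.n∣m*n q))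

  -- The square class of the discriminant for odd k − 1 = 1 + 2p.
  module _ {r k e : ℤ} (r≢0 : r ≢ 0ℤ) (k≢0 : k ≢ 0ℤ) (e≢0 : e ≢ 0ℤ) (p : ℕ) where
    open ≈-Reasoning

    -- Here m = 1 + 2q is odd: one factor r^(k - 1) k survives, its k pairs with the final k, and
    -- the odd power of r reduces to r.
    disc-even : ∀ q → (r ^ suc (p ℕ.* 2) * k) ^ suc (q ℕ.* 2) * ((k * e) ^ (q ℕ.* 2) * k) ≈ r
    disc-even q = begin
      (r ^ suc (p ℕ.* 2) * k) ^ suc (q ℕ.* 2) * ((k * e) ^ (q ℕ.* 2) * k)
        ≈⟨ ≈-*-cong (^-odd-≈ q (*-≢0 (^-≢0 (suc (p ℕ.* 2)) r≢0) k≢0))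
                    (≈-*-cong (^-even-≈ q (*-≢0 k≢0 e≢0)) (≈-refl k)) ⟩
      r ^ suc (p ℕ.* 2) * k * (1ℤ * k)
        ≡⟨ regroup (r ^ suc (p ℕ.* 2)) k ⟩
      r ^ suc (p ℕ.* 2) * (k * k)
        ≈⟨ ≈-square-factor _ k≢0 ⟩
      r ^ suc (p ℕ.* 2)
        ≈⟨ ^-odd-≈ p r≢0 ⟩
      r ∎
      where
      regroup : ∀ x k → x * k * (1ℤ * k) ≡ x * (k * k)
      regroup = solve-∀

    -- Here m is even, so the contrasts within the classes contribute a square and only k e k is
    -- left.
    disc-odd : ∀ q → (r ^ suc (p ℕ.* 2) * k) ^ (suc q ℕ.* 2) * ((k * e) ^ suc (q ℕ.* 2) * k) ≈ e
    disc-odd q = begin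
      (r ^ suc (p ℕ.* 2) * k) ^ (suc q ℕ.* 2) * ((k * e) ^ suc (q ℕ.* 2) * k)
        ≈⟨ ≈-*-cong (^-even-≈ (suc q) (*-≢0 (^-≢0 (suc (p ℕ.* 2)) r≢0) k≢0))
                    (≈-*-cong (^-odd-≈ q (*-≢0 k≢0 e≢0)) (≈-refl k)) ⟩
      1ℤ * (k * e * k)
        ≡⟨ regroup k e ⟩
      e * (k * k)
        ≈⟨ ≈-square-factor e k≢0 ⟩
      e ∎
      where
      regroup : ∀ k e → 1ℤ * (k * e * k) ≡ e * (k * k)
      regroup = solve-∀

  module _ {v r} (C : Configuration v r) (tops : TransitiveParallels C) {k′ : ℕ}
           (vr : v ℕ.+ r ≡ r ℕ.* r ℕ.+ suc k′) {j e : ℕ} (0<e : 0 ℕ.< e) (r≡k+e : r ≡ suc k′ ℕ.+ e)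
           (v≡mk : v ≡ suc j ℕ.* suc k′) where

    -- The parity of `j` decides whether the discriminant has the class of `r` or of `e`, and that
    -- class is trivial by `configuration-disc`.
    square-dichotomy : ∀ p → k′ ≡ suc (p ℕ.* 2) →
      ∃ (λ q → j ≡ q ℕ.* 2 × IsSquare r) ⊎ ∃ (λ q → j ≡ suc (q ℕ.* 2) × IsSquare e)
    square-dichotomy p refl with even-or-odd j
    ... | inj₁ (q , refl) = inj₁ (q , refl , ≈1⇒square (≈-trans
      (≈-sym (disc-even (0<⇒≢0 (r-pos C tops vr r≡k+e)) (λ ()) (0<⇒≢0 (+<+ 0<e)) p q))
      (configuration-disc C tops vr {j = q ℕ.* 2} 0<e r≡k+e v≡mk)))
    ... | inj₂ (q , refl) = inj₂ (q , refl , ≈1⇒square (≈-trans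
      (≈-sym (disc-odd (0<⇒≢0 (r-pos C tops vr r≡k+e)) (λ ()) (0<⇒≢0 (+<+ 0<e)) p q))
      (configuration-disc C tops vr {j = suc (q ℕ.* 2)} 0<e r≡k+e v≡mk)))

-- Case distinction on n and k

open import Data.Nat using (_+_; _^_)

v+r≡r²+k : ∀ n k → n ^ 2 + n + k + (n + 1) ≡ (n + 1) ℕ.* (n + 1) + k
v+r≡r²+k = unfolded
  where
  -- n ^ 2 is written out because the solver does not accept it as a power.
  unfolded : ∀ n k → n ℕ.* (n ℕ.* 1) + n + k + (n + 1) ≡ (n + 1) ℕ.* (n + 1) + k
  unfolded = ℕ-solve-∀

even-suc⇒odd : ∀ {k} → 2 ∣ suc k → ∃ λ p → k ≡ suc (p ℕ.* 2)
even-suc⇒odd (divides (suc p) eq) = p , ℕ.suc-injective eq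

module _ (n k′ : ℕ) (2∣k : 2 ∣ suc k′) where
  private
    k : ℕ
    k = suc k′

  SquareAlternative : Set
  SquareAlternative = ((2 ∣ (n ^ 2 + n) / k) × IsSquare (n + 1)) ⊎
                      ((2 ∤ (n ^ 2 + n) / k) × IsSquare (n ∸ k′))

  -- Now e = n + 1 - k is 0, so contrasts between class sums would have norm 0. Instead the second
  -- alternative is checked directly: the quotient is `n`, odd since k = n + 1 is even, and the
  -- square is 0.
  alternative-k≡n+1 : k′ ≡ n → SquareAlternative
  alternative-k≡n+1 k′≡n =
    inj₂ (subst (2 ∤_) (sym quotient) 2∤n , 0 , ℕ.m≤n⇒m∸n≡0 (ℕ.≤-reflexive (sym k′≡n)))
    where
    2∤n : 2 ∤ n
    2∤n = subst (2 ∤_) (trans (sym (proj₂ (even-suc⇒odd 2∣k))) k′≡n) (odd⇒2∤ (proj₁ (even-suc⇒odd 2∣k)))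
    factor : ∀ n → n ℕ.* (n ℕ.* 1) + n ≡ n ℕ.* suc n
    factor = ℕ-solve-∀
    quotient : (n ^ 2 + n) / k ≡ n
    quotient = trans (cong (_/ k) (trans (factor n) (cong (λ m → n ℕ.* suc m) (sym k′≡n))))
                     (m*n/n≡m n k)

  alternative-k≤n : k′ ℕ.< n → (C : Configuration (n ^ 2 + n + k) (n + 1)) →
                    TransitiveParallels C → SquareAlternative
  alternative-k≤n k′<n C tops with class-size-divides C tops (v+r≡r²+k n k)
  -- Without classes there would be no points, but v is at least k.
  ... | zero  , eq = contradiction (trans (ℕ.+-comm k _) eq) λ ()
  ... | suc j , eq = Sum.map
    (λ (q , j≡2q , square) → subst (2 ∣_) (sym quotient) (divides q j≡2q) , square)
    (λ (q , j≡1+2q , square) → subst (2 ∤_) (sym (trans quotient j≡1+2q)) (odd⇒2∤ q) , square)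
    (square-dichotomy C tops (v+r≡r²+k n k) (ℕ.m<n⇒0<n∸m k′<n) r≡k+e eq
      (proj₁ (even-suc⇒odd 2∣k)) (proj₂ (even-suc⇒odd 2∣k)))
    where
    r≡k+e : n + 1 ≡ k + (n ∸ k′)
    r≡k+e = trans (ℕ.+-comm n 1) (cong suc (sym (ℕ.m+[n∸m]≡n (ℕ.<⇒≤ k′<n))))
    -- Cancelling one k in n² + n + k = (j + 1) k shows that the quotient is one less than the
    -- number of classes.
    quotient : (n ^ 2 + n) / k ≡ j
    quotient = trans (cong (_/ k) (ℕ.+-cancelʳ-≡ k _ _ (trans eq (ℕ.+-comm k (j ℕ.* k)))))
                     (m*n/n≡m j k)

theorem5p3 : (n k : ℕ) .{{_ : NonZero n}} .{{_ : NonZero k}} →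
    2 ∣ k →
    (n % k ≡ 0) ⊎ (n % k ≡ k ∸ 1) →
    ∃ (λ (C : Configuration (n ^ 2 + n + k) (n + 1)) → TransitiveParallels C) →
    ((2 ∣ (n ^ 2 + n) / k) × IsSquare (n + 1)) ⊎
    ((2 ∤ (n ^ 2 + n) / k) × IsSquare (n ∸ (k ∸ 1)))
theorem5p3 n k@(suc k′) 2∣k residue (C , tops) with ℕ.<-cmp k′ n
-- The cases are k ≤ n, k = n + 1 and k > n + 1.
... | tri< k′<n _ _ = alternative-k≤n n k′ 2∣k k′<n C tops
... | tri≈ _ k′≡n _ = alternative-k≡n+1 n k′ 2∣k k′≡n
-- Here n < k - 1 is its own residue modulo k, and it is neither 0 nor k - 1.
... | tri> _ k′≢n n<k′ = contradiction residue
  Sum.[ (λ n%k≡0 → ℕ.≢-nonZero⁻¹ n (trans (sym n%k≡n) n%k≡0))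
      , (λ n%k≡k′ → k′≢n (trans (sym n%k≡k′) n%k≡n)) ]
  where
  n%k≡n : n % k ≡ n
  n%k≡n = m<n⇒m%n≡m (ℕ.m<n⇒m<1+n n<k′)
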